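{- The \textsc{Odd $2$-Coloring} problem can be solved in polynomial time.
   Context: All graphs are finite, simple and undirected. A graph is called odd if every vertex has odd degree (the empty graph is odd). The \textsc{Odd $2$-Coloring} problem is: given a graph $G$, determine whether $V(G)$ can be partitioned into two (possibly empty) sets $V_1,V_2$ such that both induced subgraphs $G[V_1]$ and $G[V_2]$ are odd. -}

module Defs where

open import Data.Bool.Base using (Bool; true; false)
open import Data.Fin.Base using (Fin; zero; suc)
open import Data.Fin.Subset using (Subset; inside; outside; ∣_∣; _∪_; _∩_; ⊤; ⊥)
open import Data.List.Base as List using (List; []; _∷_; _++_; length)
open import Data.Nat.Base using (ℕ; zero; suc; _+_; _*_; _%_)
open import Data.Product.Base using (Σ; ∃-syntax; _×_; _,_)
open import Data.Sum.Base using (_⊎_)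
open import Data.Vec.Base as Vec using (Vec; []; _∷_)
open import Function.Bundles using (_↔_)
open import Relation.Binary.PropositionalEquality using (_≡_)
open import Relation.Nullary using (¬_)

record Graph : Set where
  field
    order      : ℕ
    adj        : Fin order → Fin order → Bool
    adj-sym    : ∀ u v → adj u v ≡ adj v u
    adj-irrefl : ∀ v → adj v v ≡ false

  Vertex : Set
  Vertex = Fin order

  neighbours : Vertex → Subset order
  neighbours v = Vec.tabulate (adj v)

  degree : Vertex → ℕ
  degree v = ∣ neighbours v ∣

open Graph public

OddGraph : Graph → Set
OddGraph G = ∀ (v : Vertex G) → degree G v % 2 ≡ 1

-- The increasing enumeration of the elements of a subset.
element : ∀ {n} (S : Subset n) → Fin ∣ S ∣ → Fin n
element (inside  ∷ S) zero    = zero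
element (inside  ∷ S) (suc i) = suc (element S i)
element (outside ∷ S) i       = suc (element S i)

-- G [ S ] is the induced subgraph, its vertices relabelled by Fin ∣ S ∣.
_[_] : (G : Graph) → Subset (order G) → Graph
G [ S ] = record
  { order      = ∣ S ∣
  ; adj        = λ i j → adj G (element S i) (element S j)
  ; adj-sym    = λ i j → adj-sym G (element S i) (element S j)
  ; adj-irrefl = λ i → adj-irrefl G (element S i)
  }

HasOdd2Coloring : Graph → Set
HasOdd2Coloring G =
  ∃[ V₁ ] ∃[ V₂ ] (V₁ ∪ V₂ ≡ ⊤ {order G}) × (V₁ ∩ V₂ ≡ ⊥) ×
                  OddGraph (G [ V₁ ]) × OddGraph (G [ V₂ ])

data Symbol (e : ℕ) : Set where
  blank : Symbol e
  bit   : Bool → Symbol e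
  aux   : Fin e → Symbol e

data Move : Set where
  left stay right : Move

data State (Q : Set) : Set where
  running       : Q → State Q
  accept reject : State Q

record TM : Set₁ where
  field
    -- Tape 0 carries the input; there are workTapes further tapes.
    workTapes  : ℕ
    auxSymbols : ℕ
    Q          : Set
    Q-finite   : ∃[ m ] (Q ↔ Fin m)
    start      : State Q

  tapes : ℕ
  tapes = suc workTapes

  Γ : Set
  Γ = Symbol auxSymbols

  field
    δ : Q → Vec Γ tapes → State Q × Vec (Γ × Move) tapes

-- A two-way infinite tape: before lists the cells to the left of the head,
-- nearest first, after those to its right, and all further cells are blank.
record Tape (e : ℕ) : Set where
  constructor tape
  field
    before : List (Symbol e)
    head   : Symbol e
    after  : List (Symbol e)

module _ {e : ℕ} where

  moveHead : Move → Tape e → Tape e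
  moveHead left  (tape []       h rs)       = tape [] blank (h ∷ rs)
  moveHead left  (tape (l ∷ ls) h rs)       = tape ls l (h ∷ rs)
  moveHead stay  t                          = t
  moveHead right (tape ls       h [])       = tape (h ∷ ls) blank []
  moveHead right (tape ls       h (r ∷ rs)) = tape (h ∷ ls) r rs

  writeMove : Symbol e × Move → Tape e → Tape e
  writeMove (s , m) (tape ls _ rs) = moveHead m (tape ls s rs)

  blankTape : Tape e
  blankTape = tape [] blank []

  inputTape : List Bool → Tape e
  inputTape []      = blankTape
  inputTape (b ∷ w) = tape [] (bit b) (List.map bit w)

module Run (M : TM) where
  open TM M

  record Config : Set where
    constructor config
    field
      state    : State Q
      contents : Vec (Tape auxSymbols) tapes

  open Config public

  initial : List Bool → Config
  initial w = config start (inputTape w ∷ Vec.replicate workTapes blankTape)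

  step : Config → Config
  step (config (running q) ts) with δ q (Vec.map Tape.head ts)
  ... | s , acts = config s (Vec.zipWith writeMove acts ts)
  step c@(config accept _) = c
  step c@(config reject _) = c

  run : ℕ → Config → Config
  run zero    c = c
  run (suc t) c = run t (step c)

  -- Halted configurations are fixed by step, so the state after t steps is
  -- accept or reject exactly when M halts with that verdict within t steps.
  stateAfter : ℕ → List Bool → State Q
  stateAfter t w = state (run t (initial w))

-- Coefficients, constant term first.
Polynomial : Set
Polynomial = List ℕ

eval : Polynomial → ℕ → ℕ
eval []       n = 0
eval (a ∷ as) n = a + n * eval as n

record DecisionProblem : Set₁ where
  field
    Instance : Set
    encode   : Instance → List Bool
    Yes      : Instance → Set

SolvableInPolynomialTime : DecisionProblem → Set₁
SolvableInPolynomialTime P =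
  Σ TM λ M → Σ Polynomial λ p → ∀ (x : Instance) →
    let s = Run.stateAfter M (eval p (length (encode x))) (encode x)
    in (Yes x × s ≡ accept) ⊎ (¬ Yes x × s ≡ reject)
  where open DecisionProblem P

-- 1ⁿ0 followed by the rows of the n × n adjacency matrix.
encodeGraph : Graph → List Bool
encodeGraph G =
  List.replicate (order G) true ++ false ∷
  List.concat (List.tabulate λ u → List.tabulate λ v → adj G u v)

Odd2Coloring : DecisionProblem
Odd2Coloring = record
  { Instance = Graph
  ; encode   = encodeGraph
  ; Yes      = HasOdd2Coloring
  }

{-# OPTIONS --safe #-}
-- Let x be the indicator of V₁, viewed over GF(2), let r be the row of a vertex
-- v in the adjacency matrix and d the degree of v. The degree of v inside its
-- own part has the parity of d (1 + x v) + r · x, so an odd 2-coloring is a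
-- solution of the linear system (r + d e_v) · x = 1 + d, one equation for each v.
-- A four-tape machine writes down this system and eliminates one variable per
-- pass: the first equation containing the variable is added to all later ones
-- containing it and is then dropped. The system is unsolvable exactly when an
-- equation 0 = 1 is left at the end. A pass takes O(n²) steps.
module Submission where

open import Data.Bool.Base using (Bool; true; false; not; _∧_; _∨_; _xor_; if_then_else_)
open import Data.Bool.Properties using (not-involutive; not-distribˡ-xor; not-distribʳ-xor; xor-assoc; xor-comm; xor-same; xor-identityʳ; ∧-identityʳ; ∧-zeroʳ)
open import Data.Bool.Solver using (module xor-∧-Solver)
open import Data.Fin using (Fin; zero; suc; #_; toℕ)
open import Data.Fin.Properties using (all?; _≟_)
open import Data.Fin.Subset using (Subset; inside; outside; ∣_∣; _∪_; _∩_; ∁; ⊤; ⊥)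
open import Data.Fin.Subset.Properties using (p∪∁p≡⊤; ∩-inverseʳ)
open import Data.List.Base as List using (List; []; _∷_; _++_; _ʳ++_; length)
open import Data.List.Properties using (map-ʳ++; ++-ʳ++; ʳ++-ʳ++; length-ʳ++; map-++; length-++; ++-identityʳ; length-replicate; length-tabulate)
open import Data.List.Relation.Unary.All as All using (All; []; _∷_)
open import Data.List.Relation.Unary.All.Properties as All using (++⁺)
open import Data.Maybe.Base using (Maybe; just; nothing; is-just)
open import Data.Nat.Base using (ℕ; zero; suc; _+_; _*_; _%_; _≤_; z≤n; s≤s)
open import Data.Nat.Properties using (≤-refl; ≤-reflexive; ≤-trans; m≤m+n; m≤n+m; n≤1+n; +-suc; +-identityʳ; +-mono-≤; +-monoˡ-≤; +-monoʳ-≤; *-mono-≤; *-monoˡ-≤; *-monoʳ-≤; module ≤-Reasoning; m≤n⇒m≤1+n)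
open import Data.Nat.Solver using (module +-*-Solver)
open import Data.Product.Base using (∃-syntax; _×_; _,_; proj₁; proj₂)
open import Data.Sum.Base using (_⊎_; inj₁; inj₂)
open import Data.Vec.Base as Vec using (Vec; []; _∷_; lookup; tabulate; zipWith; _[_]≔_)
open import Data.Vec.Properties as Vec using (lookup-map; lookup∘tabulate; ∷-injectiveʳ)
open import Function.Base using (_∘_)
open import Function.Bundles using (_↔_; mk↔ₛ′)
open import Relation.Binary.PropositionalEquality using (_≡_; refl; sym; trans; cong; cong₂; subst; module ≡-Reasoning)
open import Relation.Nullary using (¬_; contradiction)
open import Relation.Nullary.Decidable using (from-yes)

open import Defs

-- The term d (1 + x v) comes from counting neighbours in the complement: over GF(2) that count is r
-- · x + d, so the correction is present exactly for v in V₂, and the oddness conditions of both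
-- parts merge into one linear equation per vertex. Two obstacles shape the machine. The diagonal
-- entry to be written is the parity of the whole row, known only after the row has been read, so a
-- placeholder `diag` is written first and replaced while the row is copied. And the machine keeps
-- no counters: unary marks give both the place of the diagonal and the end of a row, and every pass
-- strips the leading entry of each row it keeps, so that running out of variables shows as a row
-- beginning with its terminator. Dropping the pivot equation loses no information: it contains the
-- eliminated variable, hence can be solved for it whatever values the others take. The equations
-- before it do not contain that variable and pass through unchanged, so no rows have to be
-- exchanged.

-- Linear systems over GF(2)

-- Coefficients and right-hand side of one equation.
Row : ℕ → Set
Row m = Vec Bool m × Bool

addRows : ∀ {m} → Row m → Row m → Row m
addRows (r , b) (p , c) = zipWith _xor_ r p , b xor c

pass : ∀ {m} → List (Row (suc m)) → Maybe (Row m) → List (Row m)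
pass []                     piv      = []
pass ((false ∷ r , b) ∷ rs) piv      = (r , b) ∷ pass rs piv
pass ((true  ∷ r , b) ∷ rs) nothing  = pass rs (just (r , b))
pass ((true  ∷ r , b) ∷ rs) (just p) = addRows (r , b) p ∷ pass rs (just p)

solvable : ∀ {m} → List (Row m) → Bool
solvable {zero}  []              = true
solvable {zero}  (([] , b) ∷ rs) = not b ∧ solvable rs
solvable {suc m} rs              = solvable (pass rs nothing)

parityFrom : ∀ {n} → Bool → Vec Bool n → Bool
parityFrom d []      = d
parityFrom d (x ∷ r) = parityFrom (x xor d) r

-- The first mark equal to 1 is cleared; fill puts d at its position. The first
-- argument tells whether that mark has been passed.
clearFirst : ∀ {n} → Bool → Vec Bool n → Vec Bool n
clearFirst seen []       = []
clearFirst seen (c ∷ cs) = (seen ∧ c) ∷ clearFirst (seen ∨ c) cs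

fill : ∀ {n} → Bool → Bool → Vec Bool n → Vec Bool n → Vec Bool n
fill seen d []       []      = []
fill seen d (c ∷ cs) (x ∷ r) = (if not seen ∧ c then d else x) ∷ fill (seen ∨ c) d cs r

equation : ∀ {n} → Vec Bool n → Vec Bool n → Row n
equation cs r = fill false (parityFrom false r) cs r , not (parityFrom false r)

-- The latest equation comes first because tape `a` is written from right to left.
system : ∀ {n} → Vec Bool n → List (Vec Bool n) → List (Row n) → List (Row n)
system cs []       acc = acc
system cs (r ∷ rs) acc = system (clearFirst false cs) rs (equation cs r ∷ acc)

-- The machine

Sym : Set
Sym = Symbol 3

-- diag holds the place of a diagonal entry until the degree is known;
-- end₀ and end₁ terminate a row and carry its right-hand side.
pattern diag = aux zero
pattern end₀ = aux (suc zero)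
pattern end₁ = aux (suc (suc zero))

end : Bool → Sym
end false = end₀
end true  = end₁

-- Terminators add like the right-hand sides they carry, so one symbolwise walk along two rows of
-- equal length adds the complete equations.
_⊕_ : Sym → Sym → Sym
bit a ⊕ bit b = bit (a xor b)
end₁  ⊕ end₁  = end₀
end₁  ⊕ _     = end₁
_     ⊕ s     = s

resolve : Bool → Sym → Sym
resolve d diag = bit d
resolve d s    = s

data Q : Set where
  init header rowStart test store add : Q
  rewind copy scan emit               : Bool → Q
  sweep                               : Bool → Bool → Q

index : Q → Fin 18
index init                = # 0
index header              = # 1
index rowStart            = # 2
index test                = # 3
index store               = # 4
index add                 = # 5
index (rewind false)      = # 6
index (rewind true)       = # 7
index (copy false)        = # 8
index (copy true)         = # 9
index (scan false)        = # 10
index (scan true)         = # 11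
index (emit false)        = # 12
index (emit true)         = # 13
index (sweep false false) = # 14
index (sweep false true)  = # 15
index (sweep true false)  = # 16
index (sweep true true)   = # 17

states : Vec Q 18
states =
  init ∷ header ∷ rowStart ∷ test ∷ store ∷ add ∷
  rewind false ∷ rewind true ∷ copy false ∷ copy true ∷
  scan false ∷ scan true ∷ emit false ∷ emit true ∷
  sweep false false ∷ sweep false true ∷ sweep true false ∷ sweep true true ∷ []

lookup-index : ∀ q → lookup states (index q) ≡ q
lookup-index init                = refl
lookup-index header              = refl
lookup-index rowStart            = refl
lookup-index test                = refl
lookup-index store               = refl
lookup-index add                 = refl
lookup-index (rewind false)      = refl
lookup-index (rewind true)       = refl
lookup-index (copy false)        = refl
lookup-index (copy true)         = refl
lookup-index (scan false)        = refl
lookup-index (scan true)         = refl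
lookup-index (emit false)        = refl
lookup-index (emit true)         = refl
lookup-index (sweep false false) = refl
lookup-index (sweep false true)  = refl
lookup-index (sweep true false)  = refl
lookup-index (sweep true true)   = refl

Q↔Fin : Q ↔ Fin 18
Q↔Fin = mk↔ₛ′ index (lookup states)
  (from-yes (all? λ i → index (lookup states i) ≟ i)) lookup-index

Action : Set
Action = State Q × Vec (Sym × Move) 4

go : Q → (i p a b : Sym × Move) → Action
go q i p a b = running q , i ∷ p ∷ a ∷ b ∷ []

-- The flag tells which phase asked for the rewinding: `true` means that a pivot has been put on
-- tape `p`.
afterRewind : Bool → Q
afterRewind false = rowStart
afterRewind true  = scan true

-- The tapes are, in order:
--   i  the input;
--   p  n marks, those of the vertices already read being 0, so that the first
--      1 locates the diagonal entry of the current row; later the pivot row;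
--   a  the current system;
--   b  the row being read, later the output of the current pass.
-- In sweep seen d, seen tells whether the diagonal has been passed and d is the
-- parity of the bits read so far; in scan v and emit v, v tells whether tape p
-- holds a pivot.
δ : Q → Vec Sym 4 → Action
δ init (i ∷ p ∷ a ∷ b ∷ []) = go header (i , stay) (p , right) (a , stay) (b , stay)
δ header (bit true ∷ p ∷ a ∷ b ∷ []) = go header (bit true , right) (bit true , right) (a , stay) (b , stay)
δ header (i ∷ p ∷ a ∷ b ∷ []) = go (rewind false) (i , right) (p , left) (a , stay) (b , stay)
δ (rewind v) (i ∷ blank ∷ a ∷ b ∷ []) = go (afterRewind v) (i , stay) (blank , stay) (a , stay) (b , stay)
δ (rewind v) (i ∷ p ∷ a ∷ b ∷ []) = go (rewind v) (i , stay) (p , left) (a , stay) (b , stay)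
δ rowStart (blank ∷ p ∷ a ∷ b ∷ []) = go test (blank , stay) (p , stay) (a , right) (b , stay)
δ rowStart (i ∷ p ∷ a ∷ b ∷ []) = go (sweep false false) (i , stay) (p , right) (a , stay) (b , stay)
δ (sweep seen d) (i ∷ blank ∷ a ∷ b ∷ []) = go (copy d) (i , stay) (blank , left) (end (not d) , left) (b , left)
δ (sweep seen d) (bit x ∷ bit c ∷ a ∷ b ∷ []) =
  go (sweep (seen ∨ c) (x xor d)) (bit x , right) (bit (seen ∧ c) , right) (a , stay)
     ((if not seen ∧ c then diag else bit x) , right)
δ (sweep seen d) (i ∷ p ∷ a ∷ b ∷ []) = reject , (i , stay) ∷ (p , stay) ∷ (a , stay) ∷ (b , stay) ∷ []
δ (copy d) (i ∷ p ∷ a ∷ blank ∷ []) = go (rewind false) (i , stay) (p , stay) (a , stay) (blank , stay)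
δ (copy d) (i ∷ p ∷ a ∷ b ∷ []) = go (copy d) (i , stay) (p , stay) (resolve d b , left) (b , left)
δ test (i ∷ p ∷ blank ∷ b ∷ []) = accept , (i , stay) ∷ (p , stay) ∷ (blank , stay) ∷ (b , stay) ∷ []
δ test (i ∷ p ∷ a ∷ b ∷ []) = go (scan false) (i , stay) (p , stay) (a , stay) (b , stay)
δ (scan v) (i ∷ p ∷ end₀ ∷ b ∷ []) = go (scan v) (i , stay) (p , stay) (end₀ , right) (b , stay)
δ (scan v) (i ∷ p ∷ end₁ ∷ b ∷ []) = reject , (i , stay) ∷ (p , stay) ∷ (end₁ , stay) ∷ (b , stay) ∷ []
δ (scan v) (i ∷ p ∷ bit false ∷ b ∷ []) = go (emit v) (i , stay) (p , stay) (bit false , right) (b , stay)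
δ (scan false) (i ∷ p ∷ bit true ∷ b ∷ []) = go store (i , stay) (p , right) (bit true , right) (b , stay)
δ (scan true) (i ∷ p ∷ bit true ∷ b ∷ []) = go add (i , stay) (p , right) (bit true , right) (b , stay)
δ (scan v) (i ∷ p ∷ a ∷ b ∷ []) = go (copy false) (i , stay) (p , stay) (a , stay) (b , left)
δ (emit v) (i ∷ p ∷ bit x ∷ b ∷ []) = go (emit v) (i , stay) (p , stay) (bit x , right) (bit x , right)
δ (emit v) (i ∷ p ∷ a ∷ b ∷ []) = go (scan v) (i , stay) (p , stay) (a , right) (a , right)
δ store (i ∷ p ∷ bit x ∷ b ∷ []) = go store (i , stay) (bit x , right) (bit x , right) (b , stay)
δ store (i ∷ p ∷ a ∷ b ∷ []) = go (rewind true) (i , stay) (a , left) (a , right) (b , stay)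
δ add (i ∷ p ∷ bit x ∷ b ∷ []) = go add (i , stay) (p , right) (bit x , right) (bit x ⊕ p , right)
δ add (i ∷ p ∷ a ∷ b ∷ []) = go (rewind true) (i , stay) (p , left) (a , right) (a ⊕ p , right)

machine : TM
machine = record
  { workTapes  = 3
  ; auxSymbols = 3
  ; Q          = Q
  ; Q-finite   = 18 , Q↔Fin
  ; start      = running init
  ; δ          = δ
  }

open Run machine

-- Running times are handled in continuation-passing style: since
-- run (suc t) c = run t (step c), each lemma turns a halting proof for the
-- configuration reached into one for the configuration it starts from, and
-- quantifying the continuation over garbage on the tapes hides it.

verdict : Bool → State Q
verdict true  = accept
verdict false = reject

Halts : ℕ → Config → Bool → Set
Halts t c d = state (run t c) ≡ verdict d

at : Q → (i p a b : Tape 3) → Config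
at q i p a b = config (running q) (i ∷ p ∷ a ∷ b ∷ [])

halted : ∀ d t ts → Halts t (config (verdict d) ts) d
halted true  zero    ts = refl
halted false zero    ts = refl
halted true  (suc t) ts = halted true t ts
halted false (suc t) ts = halted false t ts

-- Halted configurations are fixed by `step`, so a running time may be overestimated at any point of
-- the analysis.
halts-mono : ∀ {d t t′ c} → t ≤ t′ → Halts t c d → Halts t′ c d
halts-mono {d} {t′ = t′} {config _ ts} z≤n refl = halted d t′ ts
halts-mono (s≤s t≤t′) h = halts-mono t≤t′ h

halts-≡ : ∀ {d t t′ c} → t ≡ t′ → Halts t c d → Halts t′ c d
halts-≡ refl h = h

-- Kept as unreduced moves: when the list in the direction of motion is a cons,
-- these compute to a tape whose next move is again of this form.
R L : List Sym → Sym → List Sym → Tape 3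
R ls h rs = moveHead right (tape ls h rs)
L ls h rs = moveHead left  (tape ls h rs)

before-write : ∀ s (t : Tape 3) → Tape.before (writeMove (s , right) t) ≡ s ∷ Tape.before t
before-write s (tape ls h [])       = refl
before-write s (tape ls h (r ∷ rs)) = refl

after-write : ∀ s (t : Tape 3) → Tape.after (writeMove (s , left) t) ≡ s ∷ Tape.after t
after-write s (tape []       h rs) = refl
after-write s (tape (l ∷ ls) h rs) = refl

-- Encoded rows and the runs of the elementary phases

bits : List Bool → List Sym
bits = List.map bit

encodeRow : ∀ {m} → Row m → List Sym
encodeRow ([]    , b) = end b ∷ []
encodeRow (x ∷ r , b) = bit x ∷ encodeRow (r , b)

encodeRows : ∀ {m} → List (Row m) → List Sym
encodeRows = List.concatMap encodeRow

data NonBlank : Sym → Set where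
  bit : ∀ b → NonBlank (bit b)
  aux : ∀ i → NonBlank (aux i)

rewind-halts : ∀ {d t} v xs {i ls h rs a b} → ls ≡ bits xs ++ blank ∷ [] →
  Halts t (at (afterRewind v) i (tape [] blank (bits xs ʳ++ h ∷ rs)) a b) d →
  Halts (length xs + suc t) (at (rewind v) i (L ls h rs) a b) d
rewind-halts v []       refl k = k
rewind-halts v (x ∷ xs) refl k = rewind-halts v xs refl k

copy-halts : ∀ {d t} e xs {i p a h rs} → All NonBlank xs →
  (∀ a′ ys → Tape.after a′ ≡ List.map (resolve e) xs ʳ++ Tape.after a →
    Halts t (at (rewind false) i p a′ (tape [] blank ys)) d) →
  Halts (length xs + suc t) (at (copy e) i p a (L xs h rs)) d
copy-halts e [] [] k = k _ _ refl
copy-halts e (bit x ∷ xs) {a = a} (_ ∷ nb) k = copy-halts e xs nb λ a′ ys eq →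
  k a′ ys (trans eq (cong (List.map (resolve e) xs ʳ++_) (after-write _ a)))
copy-halts e (aux x ∷ xs) {a = a} (_ ∷ nb) k = copy-halts e xs nb λ a′ ys eq →
  k a′ ys (trans eq (cong (List.map (resolve e) xs ʳ++_) (after-write _ a)))

emit-halts : ∀ {d t m} v (r : Row m) {i p ls h zs b} →
  (∀ ls′ h′ b′ → Tape.before b′ ≡ encodeRow r ʳ++ Tape.before b →
    Halts t (at (scan v) i p (R ls′ h′ zs) b′) d) →
  Halts (suc m + t) (at (emit v) i p (R ls h (encodeRow r ++ zs)) b) d
emit-halts v ([] , false) {b = b} k = k _ _ _ (before-write _ b)
emit-halts v ([] , true)  {b = b} k = k _ _ _ (before-write _ b)
emit-halts v (x ∷ r , c)  {b = b} k = emit-halts v (r , c) λ ls h b′ eq →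
  k ls h b′ (trans eq (cong (encodeRow (r , c) ʳ++_) (before-write _ b)))

-- Time to read m more entries of a row and then to rewind, l having been read.
rowTime : ℕ → ℕ → ℕ → ℕ
rowTime m l t = suc m + ((m + l) + suc t)

rowTime-suc : ∀ m l t → suc (rowTime m (suc l) t) ≡ rowTime (suc m) l t
rowTime-suc m l t = cong (λ k → suc (suc m + (k + suc t))) (+-suc m l)

-- `xs` holds the entries already on tape `p`, latest first. `ys` is what the marks or an earlier,
-- longer pivot left beyond the terminator, which `add` never passes.
store-halts : ∀ {d t m} (r : Row m) xs {i p ls h zs b} →
  Tape.before p ≡ bits xs ++ blank ∷ [] →
  (∀ ls′ h′ ys →
    Halts t (at (scan true) i (tape [] blank (bits xs ʳ++ encodeRow r ++ ys)) (R ls′ h′ zs) b) d) →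
  Halts (rowTime m (length xs) t) (at store i p (R ls h (encodeRow r ++ zs)) b) d
store-halts ([] , false) xs eq k = rewind-halts true xs eq (k _ _ _)
store-halts ([] , true)  xs eq k = rewind-halts true xs eq (k _ _ _)
store-halts {d} {t} {suc m} (x ∷ r , c) xs {i} {p} {ls} {h} {zs} {b} eq k =
  halts-≡ {d} {c = at store i p (R ls h (encodeRow (x ∷ r , c) ++ zs)) b} (rowTime-suc m (length xs) t)
    (store-halts (r , c) (x ∷ xs) (trans (before-write _ p) (cong (bit x ∷_) eq)) k)

add-halts : ∀ {d t m} (r q : Row m) xs {i lp hp ys ls h zs b} →
  hp ∷ lp ≡ bits xs ++ blank ∷ [] →
  (∀ ls′ h′ b′ → Tape.before b′ ≡ encodeRow (addRows r q) ʳ++ Tape.before b →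
    Halts t (at (scan true) i (tape [] blank (bits xs ʳ++ encodeRow q ++ ys)) (R ls′ h′ zs) b′) d) →
  Halts (rowTime m (length xs) t)
        (at add i (R lp hp (encodeRow q ++ ys)) (R ls h (encodeRow r ++ zs)) b) d
add-halts ([] , false) ([] , false) xs {b = b} eq k = rewind-halts true xs eq (k _ _ _ (before-write _ b))
add-halts ([] , false) ([] , true)  xs {b = b} eq k = rewind-halts true xs eq (k _ _ _ (before-write _ b))
add-halts ([] , true)  ([] , false) xs {b = b} eq k = rewind-halts true xs eq (k _ _ _ (before-write _ b))
add-halts ([] , true)  ([] , true)  xs {b = b} eq k = rewind-halts true xs eq (k _ _ _ (before-write _ b))
add-halts {d} {t} {suc m} (x ∷ r , c) (y ∷ q , e) xs {i} {lp} {hp} {ys} {ls} {h} {zs} {b} eq k =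
  halts-≡ {d} {c = at add i (R lp hp (encodeRow (y ∷ q , e) ++ ys)) (R ls h (encodeRow (x ∷ r , c) ++ zs)) b}
    (rowTime-suc m (length xs) t)
    (add-halts (r , c) (q , e) (y ∷ xs) (cong (bit y ∷_) eq) λ ls h b′ eq′ →
      k ls h b′ (trans eq′ (cong (encodeRow (addRows (r , c) (q , e)) ʳ++_) (before-write _ b))))

-- Elimination on the tapes

pivotTape : ∀ {m} → Maybe (Row m) → List Sym → List Sym
pivotTape nothing  xs = xs
pivotTape (just q) xs = encodeRow q ++ xs

scanTime : ℕ → ℕ → ℕ → ℕ
scanTime m zero    t = suc t
scanTime m (suc k) t = suc (rowTime m 0 (scanTime m k t))

scan-halts : ∀ {d t m} (rs : List (Row (suc m))) piv {i xs ls h b} →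
  (∀ xs′ ls′ h′ rs′ ys → ys ≡ encodeRows (pass rs piv) ʳ++ Tape.before b →
    Halts t (at (copy false) i (tape [] blank xs′) (tape ls′ blank []) (L ys h′ rs′)) d) →
  Halts (scanTime m (length rs) t)
    (at (scan (is-just piv)) i (tape [] blank (pivotTape piv xs)) (R ls h (encodeRows rs)) b) d
scan-halts [] nothing  k = k _ _ _ _ _ refl
scan-halts [] (just p) k = k _ _ _ _ _ refl
scan-halts {d} {t} {m} ((false ∷ r , c) ∷ rs) piv {i} {xs} {ls} {h} {b} k =
  -- Emitting leaves tape `p` alone, so the rewinding part of `rowTime` is slack here. Charging all
  -- rows alike makes the time depend on their number only.
  halts-mono {d} {c = at (emit (is-just piv)) i (tape [] blank (pivotTape piv xs)) (R (h ∷ ls) (bit false) (encodeRow (r , c) ++ encodeRows rs)) b}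
    (+-monoʳ-≤ (suc m) (≤-trans (n≤1+n _) (m≤n+m _ (m + 0))))
    (emit-halts (is-just piv) (r , c) λ ls h b′ eq → scan-halts rs piv λ xs ls′ h′ rs′ ys eq′ →
      k xs ls′ h′ rs′ ys (trans eq′ (trans (cong (encodeRows (pass rs piv) ʳ++_) eq)
        (sym (++-ʳ++ (encodeRow (r , c)))))))
-- The two cases for `xs` coincide; the split lets the move to the right on tape `p` reduce.
scan-halts ((true ∷ r , c) ∷ rs) nothing {xs = []} k =
  store-halts (r , c) [] refl λ ls h ys → scan-halts rs (just (r , c)) k
scan-halts ((true ∷ r , c) ∷ rs) nothing {xs = x ∷ xs} k =
  store-halts (r , c) [] refl λ ls h ys → scan-halts rs (just (r , c)) k
scan-halts ((true ∷ r , c) ∷ rs) (just p) k =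
  add-halts (r , c) p [] refl λ ls h b′ eq → scan-halts rs (just p) λ xs ls′ h′ rs′ ys eq′ →
      k xs ls′ h′ rs′ ys (trans eq′ (trans (cong (encodeRows (pass rs (just p)) ʳ++_) eq)
        (sym (++-ʳ++ (encodeRow (addRows (r , c) p))))))

length-pass : ∀ {m} (rs : List (Row (suc m))) piv → length (pass rs piv) ≤ length rs
length-pass []                     piv      = z≤n
length-pass ((false ∷ r , b) ∷ rs) piv      = s≤s (length-pass rs piv)
length-pass ((true  ∷ r , b) ∷ rs) nothing  = m≤n⇒m≤1+n (length-pass rs (just (r , b)))
length-pass ((true  ∷ r , b) ∷ rs) (just p) = s≤s (length-pass rs (just p))

-- `test` accepts as soon as no equation is left, possibly with variables still to be eliminated.
solvable-[] : ∀ m → solvable {m} [] ≡ true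
solvable-[] zero    = refl
solvable-[] (suc m) = solvable-[] m

length-encodeRow : ∀ {m} (r : Row m) → length (encodeRow r) ≡ suc m
length-encodeRow ([]    , b) = refl
length-encodeRow (x ∷ r , b) = cong suc (length-encodeRow (r , b))

length-encodeRows : ∀ {m} (rs : List (Row m)) → length (encodeRows rs) ≡ length rs * suc m
length-encodeRows []       = refl
length-encodeRows (r ∷ rs) =
  trans (length-++ (encodeRow r)) (cong₂ _+_ (length-encodeRow r) (length-encodeRows rs))

nonBlank-encodeRow : ∀ {m} (r : Row m) → All NonBlank (encodeRow r)
nonBlank-encodeRow ([]    , false) = aux _ ∷ []
nonBlank-encodeRow ([]    , true)  = aux _ ∷ []
nonBlank-encodeRow (x ∷ r , b)     = bit x ∷ nonBlank-encodeRow (r , b)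

nonBlank-encodeRows : ∀ {m} (rs : List (Row m)) → All NonBlank (encodeRows rs)
nonBlank-encodeRows []       = []
nonBlank-encodeRows (r ∷ rs) = ++⁺ (nonBlank-encodeRow r) (nonBlank-encodeRows rs)

all-ʳ++ : ∀ {P : Sym → Set} {xs ys} → All P xs → All P ys → All P (xs ʳ++ ys)
all-ʳ++ []         pys = pys
all-ʳ++ (px ∷ pxs) pys = all-ʳ++ pxs (px ∷ pys)

map-resolve-encodeRow : ∀ {m} (r : Row m) e → List.map (resolve e) (encodeRow r) ≡ encodeRow r
map-resolve-encodeRow ([]    , false) e = refl
map-resolve-encodeRow ([]    , true)  e = refl
map-resolve-encodeRow (x ∷ r , b)     e = cong (bit x ∷_) (map-resolve-encodeRow (r , b) e)

-- Encoded equations contain no `diag`. This is why `copy`, written for reading the matrix, can also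
-- carry the output of a pass back to tape `a`.
map-resolve-encodeRows : ∀ {m} (rs : List (Row m)) e → List.map (resolve e) (encodeRows rs) ≡ encodeRows rs
map-resolve-encodeRows []       e = refl
map-resolve-encodeRows (r ∷ rs) e =
  trans (map-++ (resolve e) (encodeRow r) (encodeRows rs))
        (cong₂ _++_ (map-resolve-encodeRow r e) (map-resolve-encodeRows rs e))

-- A tape seen from its right end is reversed, and moving leftwards over it reverses it again; hence
-- copying and rewinding preserve the order.
map-reverse-ʳ++ : ∀ {A B : Set} (f : A → B) xs {zs} → List.map f (xs ʳ++ []) ʳ++ zs ≡ List.map f xs ++ zs
map-reverse-ʳ++ f xs {zs} = trans (cong (_ʳ++ zs) (map-ʳ++ f xs)) (ʳ++-ʳ++ (List.map f xs))

length-reverse-encodeRows : ∀ {m} (rs : List (Row m)) → length (encodeRows rs ʳ++ []) ≡ length rs * suc m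
length-reverse-encodeRows rs =
  trans (length-ʳ++ (encodeRows rs)) (trans (+-identityʳ _) (length-encodeRows rs))

-- The input is exhausted by now, so `rowStart` reads a blank and hands over to `test`: the return
-- path of the reading phase also closes a pass.
endPass-halts : ∀ {d t m} (rs : List (Row m)) {li ri xs ls ys h zs} → ys ≡ encodeRows rs ʳ++ [] →
  (∀ ls′ h′ ys′ →
    Halts t (at test (tape li blank ri) (tape [] blank xs) (R ls′ h′ (encodeRows rs)) (tape [] blank ys′)) d) →
  Halts (length rs * suc m + suc (suc (suc t)))
    (at (copy false) (tape li blank ri) (tape [] blank xs) (tape ls blank []) (L ys h zs)) d
endPass-halts {d} {t} rs {li} {ri} {xs} {ls} {_} {h} {zs} refl k =
  halts-≡ {d} {c = at (copy false) (tape li blank ri) (tape [] blank xs) (tape ls blank []) (L (encodeRows rs ʳ++ []) h zs)}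
    (cong (_+ suc (suc (suc t))) (length-reverse-encodeRows rs))
    (copy-halts false (encodeRows rs ʳ++ []) (all-ʳ++ (nonBlank-encodeRows rs) []) cont)
  where
  cont : ∀ a ys → Tape.after a ≡ List.map (resolve false) (encodeRows rs ʳ++ []) ʳ++ [] →
    Halts (suc (suc t)) (at (rewind false) (tape li blank ri) (tape [] blank xs) a (tape [] blank ys)) d
  cont (tape ls h rs′) ys eq rewrite
    trans eq (trans (map-reverse-ʳ++ (resolve false) (encodeRows rs))
      (trans (++-identityʳ _) (map-resolve-encodeRows rs false))) = k ls h ys

-- A row without variables is a bare terminator: `end₀` is skipped and `end₁` rejects at once.
-- Reaching the end therefore means acceptance, which is all the continuation has to cover.
scan₀-halts : ∀ {t} (rs : List (Row 0)) {i p ls h b} →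
  (∀ ls′ → Halts t (at (copy false) i p (tape ls′ blank []) (moveHead left b)) true) →
  Halts (length rs + suc t) (at (scan false) i p (R ls h (encodeRows rs)) b) (solvable rs)
scan₀-halts []                  k = k _
scan₀-halts (([] , false) ∷ rs) k = scan₀-halts rs k
scan₀-halts {t} (([] , true) ∷ rs) k = halted false (length rs + suc t) _

-- A row costs `3 + (m + m)`: one step for the leading entry, `m + 1` for the rest and `m + 1` for
-- rewinding. Then `k * suc m` symbols are copied back, and 3 steps lead through the blank that ends
-- `copy`, `rewind` and `rowStart`. In the base case the 5 counts one step each of `scan` on a
-- blank, `copy`, `rewind`, `rowStart` and `test`.
decideTime : ℕ → ℕ → ℕ
decideTime k zero    = suc (k + 5)
decideTime k (suc m) = suc (k * (3 + (m + m)) + suc (k * suc m + (3 + decideTime k m)))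

scanTime-≡ : ∀ m k t → scanTime m k t ≡ k * (3 + (m + m)) + suc t
scanTime-≡ m zero    t = refl
scanTime-≡ m (suc k) t = trans (cong (λ s → suc (rowTime m 0 s)) (scanTime-≡ m k t))
  (solve 3 (λ m k t → con 2 :+ (m :+ (m :+ con 0 :+ (con 1 :+ (k :* (con 3 :+ (m :+ m)) :+ (con 1 :+ t)))))
                   := (con 3 :+ (m :+ m)) :+ k :* (con 3 :+ (m :+ m)) :+ (con 1 :+ t)) refl m k t)
  where open +-*-Solver

passTime-mono : ∀ m {k k′ l l′ t} → k ≤ k′ → l ≤ l′ →
  scanTime m k (l * suc m + t) ≤ k′ * (3 + (m + m)) + suc (l′ * suc m + t)
passTime-mono m {k} {k′} {l} {l′} {t} k≤ l≤ = ≤-trans (≤-reflexive (scanTime-≡ m k _))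
  (+-mono-≤ (*-monoˡ-≤ (3 + (m + m)) k≤) (s≤s (+-monoˡ-≤ t (*-monoˡ-≤ (suc m) l≤))))

-- Induction on the number of variables. `k` only bounds the number of rows, since a pass loses a
-- row just when it meets a pivot.
decide-halts : ∀ {m} (rs : List (Row m)) {k} → length rs ≤ k → ∀ {li ri xs ls h ys} →
  Halts (decideTime k m)
    (at test (tape li blank ri) (tape [] blank xs) (R ls h (encodeRows rs)) (tape [] blank ys)) (solvable rs)
decide-halts {zero}  [] {k} _ = halted true (k + 5) _
decide-halts {suc m} [] {k} _ rewrite solvable-[] m = halted true (k * (3 + (m + m)) + _) _
decide-halts {zero} rs@(([] , false) ∷ _) len {li} {ri} {xs} {ls} {h} {ys} =
  halts-mono {c = at (scan false) (tape li blank ri) (tape [] blank xs) (R ls h (encodeRows rs)) (tape [] blank ys)}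
    (+-monoˡ-≤ 5 len) (scan₀-halts rs λ ls → refl)
decide-halts {zero} rs@(([] , true) ∷ _) len {li} {ri} {xs} {ls} {h} {ys} =
  halts-mono {c = at (scan false) (tape li blank ri) (tape [] blank xs) (R ls h (encodeRows rs)) (tape [] blank ys)}
    (+-monoˡ-≤ 5 len) (scan₀-halts rs λ ls → refl)
decide-halts {suc m} rs@((_ ∷ _ , _) ∷ _) {k} len {li} {ri} {xs} {ls} {h} {ys} =
  halts-mono {c = at (scan false) (tape li blank ri) (tape [] blank xs) (R ls h (encodeRows rs)) (tape [] blank ys)}
    (passTime-mono m len shorter)
    (scan-halts rs nothing λ xs ls h zs ys eq → endPass-halts (pass rs nothing) eq λ ls h ys →
      decide-halts (pass rs nothing) shorter)
  where
  shorter : length (pass rs nothing) ≤ k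
  shorter = ≤-trans (length-pass rs nothing) len

-- Reading the adjacency matrix

-- Tape b after the sweep: fill with the entry still unknown.
sweepOutput : ∀ {n} → Bool → Vec Bool n → Vec Bool n → List Sym
sweepOutput seen []       []      = []
sweepOutput seen (c ∷ cs) (x ∷ r) = (if not seen ∧ c then diag else bit x) ∷ sweepOutput (seen ∨ c) cs r

length-sweepOutput : ∀ {n} seen (cs r : Vec Bool n) → length (sweepOutput seen cs r) ≡ n
length-sweepOutput seen []       []      = refl
length-sweepOutput seen (c ∷ cs) (x ∷ r) = cong suc (length-sweepOutput (seen ∨ c) cs r)

nonBlank-sweepOutput : ∀ {n} seen (cs r : Vec Bool n) → All NonBlank (sweepOutput seen cs r)
nonBlank-sweepOutput seen  []           []      = []
nonBlank-sweepOutput true  (c ∷ cs)     (x ∷ r) = bit x ∷ nonBlank-sweepOutput true cs r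
nonBlank-sweepOutput false (true ∷ cs)  (x ∷ r) = aux _ ∷ nonBlank-sweepOutput true cs r
nonBlank-sweepOutput false (false ∷ cs) (x ∷ r) = bit x ∷ nonBlank-sweepOutput false cs r

resolve-sweepOutput : ∀ {n} seen d b (cs r : Vec Bool n) zs →
  List.map (resolve d) (sweepOutput seen cs r) ++ end b ∷ zs ≡ encodeRow (fill seen d cs r , b) ++ zs
resolve-sweepOutput seen  d b []           []      zs = refl
resolve-sweepOutput true  d b (c ∷ cs)     (x ∷ r) zs = cong (bit x ∷_) (resolve-sweepOutput true d b cs r zs)
resolve-sweepOutput false d b (true ∷ cs)  (x ∷ r) zs = cong (bit d ∷_) (resolve-sweepOutput true d b cs r zs)
resolve-sweepOutput false d b (false ∷ cs) (x ∷ r) zs = cong (bit x ∷_) (resolve-sweepOutput false d b cs r zs)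

vbits : ∀ {n} → Vec Bool n → List Sym
vbits v = bits (Vec.toList v)

marks : ∀ {n} → Vec Bool n → Tape 3
marks cs = tape [] blank (vbits cs ++ blank ∷ [])

-- The rows of the input have no separators; the blank after the `n` marks on tape `p` is what ends
-- the sweep.
sweep-halts : ∀ {d t n} seen e (cs r : Vec Bool n) xs {li hi zs lp hp a b} →
  hp ∷ lp ≡ bits xs ++ blank ∷ [] →
  (∀ li′ hi′ lp′ h′ rs′ ys →
    lp′ ≡ bits (Vec.toList (clearFirst seen cs) ʳ++ xs) ++ blank ∷ [] →
    ys ≡ sweepOutput seen cs r ʳ++ Tape.before b →
    Halts t (at (copy (parityFrom e r)) (R li′ hi′ zs) (L lp′ blank [])
                (writeMove (end (not (parityFrom e r)) , left) a) (L ys h′ rs′)) d) →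
  Halts (n + suc t) (at (sweep seen e) (R li hi (vbits r ++ zs)) (R lp hp (vbits cs ++ blank ∷ [])) a b) d
sweep-halts seen e [] [] xs eq k = k _ _ _ _ _ _ eq refl
sweep-halts seen e (c ∷ cs) (x ∷ r) xs {b = b} eq k =
  sweep-halts (seen ∨ c) (x xor e) cs r ((seen ∧ c) ∷ xs) (cong (bit (seen ∧ c) ∷_) eq)
    λ li hi lp h rs ys eq₁ eq₂ → k li hi lp h rs ys eq₁
      (trans eq₂ (cong (sweepOutput (seen ∨ c) cs r ʳ++_) (before-write _ b)))

-- One step of `rowStart`, then `n + 1` steps for each of `sweep`, `copy` and `rewind`.
readTime : ℕ → ℕ → ℕ
readTime n t = suc (n + suc (n + suc (n + suc t)))

length-reverse-toList : ∀ {n} (cs : Vec Bool n) → length (Vec.toList cs ʳ++ []) ≡ n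
length-reverse-toList cs = trans (length-ʳ++ (Vec.toList cs)) (trans (+-identityʳ _) (Vec.length-toList cs))

readRow-halts : ∀ {d t n} (cs r : Vec Bool (suc n)) (acc : List (Row (suc n))) {li hi zs a ys} →
  Tape.after a ≡ encodeRows acc →
  (∀ li′ hi′ a′ ys′ → Tape.after a′ ≡ encodeRows (equation cs r ∷ acc) →
    Halts t (at rowStart (R li′ hi′ zs) (marks (clearFirst false cs)) a′ (tape [] blank ys′)) d) →
  Halts (readTime (suc n) t)
    (at rowStart (R li hi (vbits r ++ zs)) (marks cs) a (tape [] blank ys)) d
readRow-halts {d} {t} {n} cs r@(_ ∷ _) acc {zs = zs} {a = a} eqa k =
  sweep-halts false false cs r [] refl cont
  where
  e = parityFrom false r
  cs′ = Vec.toList (clearFirst false cs)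
  out = sweepOutput false cs r

  a₁ : Tape 3
  a₁ = writeMove (end (not e) , left) a

  length-out : length (out ʳ++ []) ≡ suc n
  length-out = trans (length-ʳ++ out) (trans (+-identityʳ _) (length-sweepOutput false cs r))

  cont : ∀ li hi lp h rs ys → lp ≡ bits (cs′ ʳ++ []) ++ blank ∷ [] → ys ≡ out ʳ++ [] →
    Halts (suc n + suc (suc n + suc t)) (at (copy e) (R li hi zs) (L lp blank []) a₁ (L ys h rs)) d
  cont li hi lp h rs _ eqp refl =
    halts-≡ {d} {c = at (copy e) (R li hi zs) (L lp blank []) a₁ (L (out ʳ++ []) h rs)}
      (cong₂ (λ j l → j + suc (l + suc t)) length-out (length-reverse-toList (clearFirst false cs)))
      (copy-halts e (out ʳ++ []) (all-ʳ++ (nonBlank-sweepOutput false cs r) [])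
        λ a₂ ys eqa₂ → rewind-halts false (cs′ ʳ++ []) eqp
          (subst (λ z → Halts t (at rowStart (R li hi zs) (tape [] blank z) a₂ (tape [] blank ys)) d)
            (sym (map-reverse-ʳ++ bit cs′))
            (k li hi a₂ ys (begin
              Tape.after a₂                                              ≡⟨ eqa₂ ⟩
              List.map (resolve e) (out ʳ++ []) ʳ++ Tape.after a₁        ≡⟨ map-reverse-ʳ++ (resolve e) out ⟩
              List.map (resolve e) out ++ Tape.after a₁                  ≡⟨ cong (List.map (resolve e) out ++_) (trans (after-write _ a) (cong (_ ∷_) eqa)) ⟩
              List.map (resolve e) out ++ end (not e) ∷ encodeRows acc   ≡⟨ resolve-sweepOutput false e (not e) cs r _ ⟩
              encodeRows (equation cs r ∷ acc)                           ∎))))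
    where open ≡-Reasoning

inputRows : ∀ {n} → List (Vec Bool n) → List Sym
inputRows = List.concatMap vbits

readRowsTime : ℕ → ℕ → ℕ → ℕ
readRowsTime n zero    t = t
readRowsTime n (suc k) t = readTime n (readRowsTime n k t)

readRows-halts : ∀ {d t n} (cs : Vec Bool (suc n)) rs acc {li hi a ys} →
  Tape.after a ≡ encodeRows acc →
  (∀ li′ hi′ cs′ a′ ys′ → Tape.after a′ ≡ encodeRows (system cs rs acc) →
    Halts t (at rowStart (R li′ hi′ []) (marks {suc n} cs′) a′ (tape [] blank ys′)) d) →
  Halts (readRowsTime (suc n) (length rs) t)
    (at rowStart (R li hi (inputRows rs)) (marks cs) a (tape [] blank ys)) d
readRows-halts cs []       acc eq k = k _ _ _ _ _ eq
readRows-halts cs (r ∷ rs) acc eq k = readRow-halts cs r acc eq λ li hi a ys eq′ →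
  readRows-halts (clearFirst false cs) rs (equation cs r ∷ acc) eq′ k

headerTime : ℕ → ℕ → ℕ → ℕ
headerTime zero    l t = suc (l + suc t)
headerTime (suc n) l t = suc (headerTime n (suc l) t)

inputFrom : List Sym → List Bool → Tape 3
inputFrom ls []      = tape ls blank []
inputFrom ls (x ∷ w) = tape ls (bit x) (bits w)

header-halts : ∀ {d t} n xs {ls w a b} →
  (∀ li → Halts t (at rowStart (R li (bit false) (bits w))
    (tape [] blank (bits (List.replicate n true ʳ++ xs) ʳ++ blank ∷ [])) a b) d) →
  Halts (headerTime n (length xs) t)
    (at header (inputFrom ls (List.replicate n true ++ false ∷ w)) (tape (bits xs ++ blank ∷ []) blank []) a b) d
header-halts zero          xs k = rewind-halts false xs refl (k _)
header-halts (suc zero)    xs k = header-halts zero (true ∷ xs) k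
header-halts (suc (suc n)) xs k = header-halts (suc n) (true ∷ xs) k

toList-tabulate : ∀ {n} (f : Fin n → Bool) → Vec.toList (tabulate f) ≡ List.tabulate f
toList-tabulate {zero}  f = refl
toList-tabulate {suc n} f = cong (f zero ∷_) (toList-tabulate (f ∘ suc))

bits-matrix : ∀ {k n} (f : Fin k → Fin n → Bool) →
  bits (List.concat (List.tabulate λ u → List.tabulate (f u))) ≡ inputRows (List.tabulate λ u → tabulate (f u))
bits-matrix {zero}  f = refl
bits-matrix {suc k} f = trans
  (map-++ bit (List.tabulate (f zero)) _)
  (cong₂ _++_ (cong bits (sym (toList-tabulate (f zero)))) (bits-matrix (f ∘ suc)))

length-system : ∀ {n} (cs : Vec Bool n) rs acc → length (system cs rs acc) ≡ length rs + length acc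
length-system cs []       acc = refl
length-system cs (r ∷ rs) acc =
  trans (length-system (clearFirst false cs) rs (equation cs r ∷ acc)) (+-suc (length rs) (length acc))

graphSystem : ∀ {n} → (Fin n → Fin n → Bool) → List (Row n)
graphSystem {n} f = system (Vec.replicate n true) (List.tabulate λ u → tabulate (f u)) []

length-graphSystem : ∀ {n} (f : Fin n → Fin n → Bool) → length (graphSystem f) ≡ n
length-graphSystem {n} f =
  trans (length-system (Vec.replicate n true) rows []) (trans (+-identityʳ _) (length-tabulate _))
  where rows = List.tabulate λ u → tabulate (f u)

decideFrom-halts : ∀ {n} (f : Fin n → Fin n → Bool) {li ri xs a ys} →
  Tape.after a ≡ encodeRows (graphSystem f) →
  Halts (suc (decideTime n n))
    (at rowStart (tape li blank ri) (tape [] blank xs) a (tape [] blank ys)) (solvable (graphSystem f))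
decideFrom-halts f {a = tape ls h rs} refl = decide-halts (graphSystem f) (≤-reflexive (length-graphSystem f))

readMatrix-halts : ∀ {n} (f : Fin n → Fin n → Bool) {li hi} →
  Halts (readRowsTime n n (suc (decideTime n n)))
    (at rowStart (R li hi (inputRows (List.tabulate λ u → tabulate (f u))))
      (marks (Vec.replicate n true)) blankTape blankTape)
    (solvable (graphSystem f))
-- `readRow-halts` needs a nonempty row for `rowStart` to see a bit. The empty graph has no row to
-- read, and its system is empty.
readMatrix-halts {zero}  f {li} {hi} = decideFrom-halts f {hi ∷ li} {[]} {blank ∷ []} {blankTape} {[]} refl
readMatrix-halts {suc n} f {li} {hi} =
  halts-≡ {c = at rowStart (R li hi (inputRows rows)) (marks (Vec.replicate (suc n) true)) blankTape blankTape}
    (cong (λ k → readRowsTime (suc n) k (suc (decideTime (suc n) (suc n)))) (length-tabulate λ u → tabulate (f u)))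
    (readRows-halts (Vec.replicate (suc n) true) rows [] {ys = []} refl λ li hi cs a ys eq → decideFrom-halts f eq)
  where rows = List.tabulate λ u → tabulate (f u)

inputTape≡inputFrom : ∀ w → inputTape w ≡ inputFrom [] w
inputTape≡inputFrom []      = refl
inputTape≡inputFrom (x ∷ w) = refl

totalTime : ℕ → ℕ
totalTime n = suc (headerTime n 0 (readRowsTime n n (suc (decideTime n n))))

machine-halts : ∀ G → Halts (totalTime (order G)) (initial (encodeGraph G)) (solvable (graphSystem (adj G)))
machine-halts G rewrite inputTape≡inputFrom (encodeGraph G) = header-halts n [] λ li →
  subst (λ z → Halts (readRowsTime n n (suc (decideTime n n)))
          (at rowStart (R li (bit false) (bits w)) (tape [] blank z) blankTape blankTape) (solvable (graphSystem (adj G))))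
    (sym (trans (map-reverse-ʳ++ bit (List.replicate n true))
                (cong (λ z → bits z ++ blank ∷ []) (sym (Vec.toList-replicate n true)))))
    (subst (λ z → Halts (readRowsTime n n (suc (decideTime n n)))
             (at rowStart (R li (bit false) z) (marks (Vec.replicate n true)) blankTape blankTape) (solvable (graphSystem (adj G))))
      (sym (bits-matrix (adj G)))
      (readMatrix-halts (adj G) {li} {bit false}))
  where
  n = order G
  w = List.concat (List.tabulate λ u → List.tabulate λ v → adj G u v)

-- The time bound

headerTime-≡ : ∀ n l t → headerTime n l t ≡ n + suc ((n + l) + suc t)
headerTime-≡ zero    l t = refl
headerTime-≡ (suc n) l t =
  cong suc (trans (headerTime-≡ n (suc l) t) (cong (λ k → n + suc (k + suc t)) (+-suc n l)))

readRowsTime-≡ : ∀ n k t → readRowsTime n k t ≡ k * (4 + 3 * n) + t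
readRowsTime-≡ n zero    t = refl
readRowsTime-≡ n (suc k) t = trans (cong (readTime n) (readRowsTime-≡ n k t))
  (solve 3 (λ n k t → con 1 :+ (n :+ (con 1 :+ (n :+ (con 1 :+ (n :+ (con 1 :+ (k :* (con 4 :+ con 3 :* n) :+ t)))))))
                   := (con 4 :+ con 3 :* n) :+ k :* (con 4 :+ con 3 :* n) :+ t) refl n k t)
  where open +-*-Solver

-- Scanning and copying back cost `1 + 3 * suc m` steps per row in a pass. Relaxing this to
-- `3 + 3 * n`, and the additive 5 to 6, gives all passes and the base case one common bound.
decideTime-≤ : ∀ k {m n} → m ≤ n → decideTime k m ≤ suc m * (6 + k * (3 + 3 * n))
decideTime-≤ k {zero}  {n} _ = begin
  suc (k + 5)                       ≡⟨ solve 1 (λ k → con 1 :+ (k :+ con 5) := con 6 :+ k :* con 1) refl k ⟩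
  6 + k * 1                         ≤⟨ +-monoʳ-≤ 6 (*-monoʳ-≤ k (s≤s z≤n)) ⟩
  6 + k * (3 + 3 * n)               ≡⟨ +-identityʳ _ ⟨
  1 * (6 + k * (3 + 3 * n))         ∎
  where
  open +-*-Solver
  open ≤-Reasoning
decideTime-≤ k {suc m} {n} m<n = begin
  suc (k * (3 + (m + m)) + suc (k * suc m + (3 + decideTime k m)))
    ≡⟨ solve 3 (λ k m t → con 1 :+ (k :* (con 3 :+ (m :+ m)) :+ (con 1 :+ (k :* (con 1 :+ m) :+ (con 3 :+ t))))
                       := con 5 :+ k :* (con 1 :+ con 3 :* (con 1 :+ m)) :+ t) refl k m (decideTime k m) ⟩
  (5 + k * (1 + 3 * suc m)) + decideTime k m
    ≤⟨ +-mono-≤ (+-mono-≤ {5} {6} (n≤1+n 5) (*-monoʳ-≤ k (+-mono-≤ {1} {3} (s≤s z≤n) (*-monoʳ-≤ 3 m<n))))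
                (decideTime-≤ k (≤-trans (n≤1+n m) m<n)) ⟩
  suc (suc m) * (6 + k * (3 + 3 * n)) ∎
  where
  open +-*-Solver
  open ≤-Reasoning

-- The expansion of (4 + 6n + 3n²) + (1 + n)(6 + 3n + 3n²): the cost of reading plus `decideTime-≤`
-- with `n` rows and `n` variables.
bound : Polynomial
bound = 10 ∷ 15 ∷ 9 ∷ 3 ∷ []

totalTime-≤ : ∀ n → totalTime n ≤ eval bound n
totalTime-≤ n = begin
  suc (headerTime n 0 (readRowsTime n n (suc (decideTime n n))))
    ≡⟨ cong suc (headerTime-≡ n 0 _) ⟩
  suc (n + suc ((n + 0) + suc (readRowsTime n n (suc (decideTime n n)))))
    ≡⟨ cong (λ t → suc (n + suc ((n + 0) + suc t))) (readRowsTime-≡ n n _) ⟩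
  suc (n + suc ((n + 0) + suc (n * (4 + 3 * n) + suc (decideTime n n))))
    ≡⟨ solve 2 (λ n t → con 1 :+ (n :+ (con 1 :+ (n :+ con 0 :+ (con 1 :+ (n :* (con 4 :+ con 3 :* n) :+ (con 1 :+ t))))))
                     := con 4 :+ con 6 :* n :+ con 3 :* (n :* n) :+ t) refl n (decideTime n n) ⟩
  (4 + 6 * n + 3 * (n * n)) + decideTime n n
    ≤⟨ +-monoʳ-≤ (4 + 6 * n + 3 * (n * n)) (decideTime-≤ n ≤-refl) ⟩
  (4 + 6 * n + 3 * (n * n)) + suc n * (6 + n * (3 + 3 * n))
    ≡⟨ solve 1 (λ n → con 4 :+ con 6 :* n :+ con 3 :* (n :* n) :+ (con 1 :+ n) :* (con 6 :+ n :* (con 3 :+ con 3 :* n))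
                   := con 10 :+ n :* (con 15 :+ n :* (con 9 :+ n :* (con 3 :+ n :* con 0)))) refl n ⟩
  eval bound n ∎
  where
  open +-*-Solver
  open ≤-Reasoning

eval-mono : ∀ p {m n} → m ≤ n → eval p m ≤ eval p n
eval-mono []       m≤n = z≤n
eval-mono (a ∷ as) m≤n = +-monoʳ-≤ a (*-mono-≤ m≤n (eval-mono as m≤n))

-- The unary header alone is this long. With `eval-mono`, a bound in the order becomes one in the
-- length of the input.
order≤length : ∀ G → order G ≤ length (encodeGraph G)
order≤length G = ≤-trans
  (≤-trans (≤-reflexive (sym (length-replicate (order G)))) (m≤m+n _ _))
  (≤-reflexive (sym (length-++ (List.replicate (order G) true))))

machine-verdict : ∀ G →
  stateAfter (eval bound (length (encodeGraph G))) (encodeGraph G) ≡ verdict (solvable (graphSystem (adj G)))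
machine-verdict G = halts-mono {c = initial (encodeGraph G)}
  (≤-trans (totalTime-≤ (order G)) (eval-mono bound (order≤length G))) (machine-halts G)

-- Correctness of elimination

dot : ∀ {n} → Vec Bool n → Vec Bool n → Bool
dot []      []      = false
dot (a ∷ r) (y ∷ x) = (a ∧ y) xor dot r x

Satisfies : ∀ {m} → Vec Bool m → Row m → Set
Satisfies x (r , b) = dot r x ≡ b

dot-xor : ∀ {n} (r q x : Vec Bool n) → dot (zipWith _xor_ r q) x ≡ dot r x xor dot q x
dot-xor []      []      []      = refl
dot-xor (a ∷ r) (b ∷ q) (y ∷ x) = trans (cong (((a xor b) ∧ y) xor_) (dot-xor r q x))
  (solve 5 (λ a b y s t → (a :+ b) :* y :+ (s :+ t) := (a :* y :+ s) :+ (b :* y :+ t)) refl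
    a b y (dot r x) (dot q x))
  where open xor-∧-Solver

xor-cancel : ∀ y s t → (y xor s) xor (y xor t) ≡ s xor t
xor-cancel false s t = refl
xor-cancel true  s t = trans (sym (not-distribˡ-xor s (not t)))
  (trans (cong not (sym (not-distribʳ-xor s t))) (not-involutive _))

-- Over GF(2) adding the pivot is its own inverse: adding it once more recovers the original
-- equation.
pass-pivot-sound : ∀ {m} (rs : List (Row (suc m))) {q c y x} → y xor dot q x ≡ c →
  All (Satisfies x) (pass rs (just (q , c))) → All (Satisfies (y ∷ x)) rs
pass-pivot-sound []                     piv sats         = []
pass-pivot-sound ((false ∷ r , b) ∷ rs) piv (sat ∷ sats) = sat ∷ pass-pivot-sound rs piv sats
pass-pivot-sound ((true  ∷ r , b) ∷ rs) {q} {c} {y} {x} piv (sat ∷ sats) =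
  (begin
    y xor dot r x                                ≡⟨ xor-cancel (dot q x) _ _ ⟨
    (dot q x xor y) xor (dot q x xor dot r x)    ≡⟨ cong₂ _xor_ (trans (xor-comm (dot q x) y) piv)
                                                       (trans (xor-comm (dot q x) _) (trans (sym (dot-xor r q x)) sat)) ⟩
    c xor (b xor c)                              ≡⟨ cong (c xor_) (xor-comm b c) ⟩
    c xor (c xor b)                              ≡⟨ xor-assoc c c b ⟨
    (c xor c) xor b                              ≡⟨ cong (_xor b) (xor-same c) ⟩
    b                                            ∎)
  ∷ pass-pivot-sound rs piv sats
  where open ≡-Reasoning

pass-pivot-complete : ∀ {m} (rs : List (Row (suc m))) {q c y x} → y xor dot q x ≡ c →
  All (Satisfies (y ∷ x)) rs → All (Satisfies x) (pass rs (just (q , c)))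
pass-pivot-complete []                     piv sats         = []
pass-pivot-complete ((false ∷ r , b) ∷ rs) piv (sat ∷ sats) = sat ∷ pass-pivot-complete rs piv sats
pass-pivot-complete ((true  ∷ r , b) ∷ rs) {q} {c} {y} {x} piv (sat ∷ sats) =
  trans (dot-xor r q x) (trans (sym (xor-cancel y _ _)) (cong₂ _xor_ sat piv))
  ∷ pass-pivot-complete rs piv sats

-- Back substitution: the pivot determines the eliminated variable, and the rows before it hold for
-- either value.
pass-sound : ∀ {m} (rs : List (Row (suc m))) {x} → All (Satisfies x) (pass rs nothing) →
  ∃[ y ] All (Satisfies (y ∷ x)) rs
-- Without a pivot the variable is free; `false` is an arbitrary choice.
pass-sound []                     sats         = false , []
pass-sound ((false ∷ r , b) ∷ rs) (sat ∷ sats) with pass-sound rs sats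
... | y , sats′ = y , sat ∷ sats′
pass-sound ((true  ∷ r , b) ∷ rs) {x} sats = b xor dot r x , piv ∷ pass-pivot-sound rs piv sats
  where
  piv : (b xor dot r x) xor dot r x ≡ b
  piv = trans (xor-assoc b _ _) (trans (cong (b xor_) (xor-same (dot r x))) (xor-identityʳ b))

pass-complete : ∀ {m} (rs : List (Row (suc m))) {y x} → All (Satisfies (y ∷ x)) rs →
  All (Satisfies x) (pass rs nothing)
pass-complete []                     sats         = []
pass-complete ((false ∷ r , b) ∷ rs) (sat ∷ sats) = sat ∷ pass-complete rs sats
pass-complete ((true  ∷ r , b) ∷ rs) (sat ∷ sats) = pass-pivot-complete rs sat sats

solvable-sound : ∀ {m} (rs : List (Row m)) → solvable rs ≡ true → ∃[ x ] All (Satisfies x) rs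
solvable-sound {zero}  []                  eq = [] , []
solvable-sound {zero}  (([] , false) ∷ rs) eq with solvable-sound rs eq
... | [] , sats = [] , refl ∷ sats
solvable-sound {suc m} rs                  eq with solvable-sound (pass rs nothing) eq
... | x , sats = let y , sats′ = pass-sound rs sats in y ∷ x , sats′

solvable-complete : ∀ {m} (rs : List (Row m)) {x} → All (Satisfies x) rs → solvable rs ≡ true
solvable-complete {zero}  []                      []            = refl
solvable-complete {zero}  (([] , b) ∷ rs) {[]}    (refl ∷ sats) = solvable-complete rs sats
solvable-complete {suc m} rs              {y ∷ x} sats          = solvable-complete (pass rs nothing) (pass-complete rs sats)

-- The equations of the graph

clears : ∀ {n} → ℕ → Vec Bool n → Vec Bool n
clears zero    cs = cs
clears (suc k) cs = clears k (clearFirst false cs)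

clearFirst-true : ∀ {n} (cs : Vec Bool n) → clearFirst true cs ≡ cs
clearFirst-true []       = refl
clearFirst-true (c ∷ cs) = cong (c ∷_) (clearFirst-true cs)

clears-∷ : ∀ {n} k (cs : Vec Bool n) → clears k (false ∷ cs) ≡ false ∷ clears k cs
clears-∷ zero    cs = refl
clears-∷ (suc k) cs = clears-∷ k (clearFirst false cs)

fill-true : ∀ {n} d (cs r : Vec Bool n) → fill true d cs r ≡ r
fill-true d []       []      = refl
fill-true d (c ∷ cs) (x ∷ r) = cong (x ∷_) (fill-true d cs r)

-- After `toℕ v` rows the marks are that many zeros followed by ones, so the first remaining 1 sits
-- at position `v`.
fill-clears : ∀ {n} d (v : Fin n) r → fill false d (clears (toℕ v) (Vec.replicate n true)) r ≡ r [ v ]≔ d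
fill-clears {suc n} d zero    (x ∷ r) = cong (d ∷_) (fill-true d (Vec.replicate n true) r)
fill-clears {suc n} d (suc v) (x ∷ r)
  rewrite clearFirst-true (Vec.replicate n true) | clears-∷ (toℕ v) (Vec.replicate n true) =
  cong (x ∷_) (fill-clears d v r)

-- Stated through `All`, so the reversal by the accumulator never has to be undone;
-- `clears (toℕ i) cs` are the marks met by row `i`.
system-all⁻ : ∀ {n k} {P : Row n → Set} cs (row : Fin k → Vec Bool n) acc →
  All P (system cs (List.tabulate row) acc) →
  All P acc × (∀ i → P (equation (clears (toℕ i) cs) (row i)))
system-all⁻ {k = zero}  cs row acc ps = ps , λ ()
system-all⁻ {k = suc k} {P} cs row acc ps
  with system-all⁻ {P = P} (clearFirst false cs) (row ∘ suc) (equation cs (row zero) ∷ acc) ps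
... | p ∷ ps′ , f = ps′ , λ { zero → p ; (suc i) → f i }

system-all⁺ : ∀ {n k} {P : Row n → Set} cs (row : Fin k → Vec Bool n) acc →
  All P acc → (∀ i → P (equation (clears (toℕ i) cs) (row i))) →
  All P (system cs (List.tabulate row) acc)
system-all⁺ {k = zero}  cs row acc ps f = ps
system-all⁺ {k = suc k} {P} cs row acc ps f =
  system-all⁺ {P = P} (clearFirst false cs) (row ∘ suc) (equation cs (row zero) ∷ acc) (f zero ∷ ps) (f ∘ suc)

parity : ∀ {n} → Vec Bool n → Bool
parity = parityFrom false

parityFrom-xor : ∀ {n} d (r : Vec Bool n) → parityFrom d r ≡ d xor parity r
parityFrom-xor d []      = sym (xor-identityʳ d)
parityFrom-xor d (x ∷ r) = begin
  parityFrom (x xor d) r        ≡⟨ parityFrom-xor (x xor d) r ⟩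
  (x xor d) xor parity r        ≡⟨ cong (_xor parity r) (xor-comm x d) ⟩
  (d xor x) xor parity r        ≡⟨ xor-assoc d x (parity r) ⟩
  d xor (x xor parity r)        ≡⟨ cong (λ z → d xor (z xor parity r)) (xor-identityʳ x) ⟨
  d xor ((x xor false) xor parity r) ≡⟨ cong (d xor_) (parityFrom-xor (x xor false) r) ⟨
  d xor parity (x ∷ r)          ∎
  where open ≡-Reasoning

-- Together, `x` and its complement count every 1 of `r` once.
dot-∁ : ∀ {n} (r x : Vec Bool n) → dot r (∁ x) ≡ dot r x xor parity r
dot-∁ []      []      = refl
dot-∁ (a ∷ r) (y ∷ x) = begin
  (a ∧ not y) xor dot r (∁ x)                  ≡⟨ cong₂ _xor_ (∧-not a y) (dot-∁ r x) ⟩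
  ((a ∧ y) xor a) xor (dot r x xor parity r)
    ≡⟨ solve 4 (λ s a t p → (s :+ a) :+ (t :+ p) := (s :+ t) :+ (a :+ p)) refl (a ∧ y) a (dot r x) (parity r) ⟩
  ((a ∧ y) xor dot r x) xor (a xor parity r)
    ≡⟨ cong (((a ∧ y) xor dot r x) xor_) (trans (cong (_xor parity r) (sym (xor-identityʳ a)))
                                                (sym (parityFrom-xor (a xor false) r))) ⟩
  dot (a ∷ r) (y ∷ x) xor parity (a ∷ r)       ∎
  where
  open ≡-Reasoning
  open xor-∧-Solver
  ∧-not : ∀ a y → a ∧ not y ≡ (a ∧ y) xor a
  ∧-not false y     = refl
  ∧-not true  true  = refl
  ∧-not true  false = refl

-- Overwriting a zero entry by `d` adds `d` times the unit vector at `v`; the zero is there because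
-- graphs have no loops.
dot-update : ∀ {n} (v : Fin n) d (r x : Vec Bool n) → lookup r v ≡ false →
  dot (r [ v ]≔ d) x ≡ (d ∧ lookup x v) xor dot r x
dot-update zero    d (false ∷ r) (y ∷ x) refl = refl
dot-update (suc v) d (a ∷ r)     (y ∷ x) eq   = trans (cong ((a ∧ y) xor_) (dot-update v d r x eq))
  (solve 3 (λ s t p → s :+ (t :+ p) := t :+ (s :+ p)) refl (a ∧ y) (d ∧ lookup x v) (dot r x))
  where open xor-∧-Solver

OddAt : ∀ {n} → Vec Bool n → Vec Bool n → Fin n → Set
OddAt r x v = lookup x v ≡ true → dot r x ≡ true

equation⇒odd : ∀ {n} (v : Fin n) r x → lookup r v ≡ false →
  dot (r [ v ]≔ parity r) x ≡ not (parity r) → OddAt r x v × OddAt r (∁ x) v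
equation⇒odd v r x rv sat rewrite dot-update v (parity r) r x rv | dot-∁ r x | lookup-map v not x
  -- `sat` is now a Boolean identity in three bits, and the four omitted combinations violate it.
  with lookup x v | parity r | dot r x
... | true  | true  | true  = (λ _ → refl) , λ ()
... | true  | false | true  = (λ _ → refl) , λ ()
... | false | true  | false = (λ ()) , λ _ → refl
... | false | false | true  = (λ ()) , λ _ → refl

odd⇒equation : ∀ {n} (v : Fin n) r x → lookup r v ≡ false →
  OddAt r x v → OddAt r (∁ x) v → dot (r [ v ]≔ parity r) x ≡ not (parity r)
odd⇒equation v r x rv odd₁ odd₂ rewrite dot-update v (parity r) r x rv | dot-∁ r x | lookup-map v not x
  with lookup x v | parity r | dot r x
... | true  | true  | true  = refl
... | true  | false | true  = refl
-- Where the equation fails, the oddness condition of the part containing `v` is itself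
-- contradictory and yields the goal.
... | true  | true  | false = sym (odd₁ refl)
... | true  | false | false = odd₁ refl
... | false | true  | false = refl
... | false | false | true  = refl
... | false | true  | true  = sym (odd₂ refl)
... | false | false | false = odd₂ refl

-- Degrees in induced subgraphs

isOdd : ℕ → Bool
isOdd zero    = false
isOdd (suc n) = not (isOdd n)

isOdd⇒%2 : ∀ n → isOdd n ≡ true → n % 2 ≡ 1
isOdd⇒%2 (suc zero)    eq = refl
isOdd⇒%2 (suc (suc n)) eq = isOdd⇒%2 n (trans (sym (not-involutive _)) eq)

%2⇒isOdd : ∀ n → n % 2 ≡ 1 → isOdd n ≡ true
%2⇒isOdd (suc zero)    eq = refl
%2⇒isOdd (suc (suc n)) eq = trans (not-involutive _) (%2⇒isOdd n eq)

isOdd-∣∷∣ : ∀ {n} b (S : Subset n) → isOdd ∣ b ∷ S ∣ ≡ b xor isOdd ∣ S ∣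
isOdd-∣∷∣ true  S = refl
isOdd-∣∷∣ false S = refl

-- The bridge from relabelled induced subgraphs to linear algebra: restricting `f` to `S` and
-- counting modulo 2 is an inner product with the indicator of `S`.
isOdd-element : ∀ {n} (S : Subset n) (f : Fin n → Bool) →
  isOdd ∣ tabulate (f ∘ element S) ∣ ≡ dot (tabulate f) S
isOdd-element []           f = refl
isOdd-element (inside ∷ S) f = trans (isOdd-∣∷∣ (f zero) (tabulate (f ∘ suc ∘ element S)))
  (cong₂ _xor_ (sym (∧-identityʳ (f zero))) (isOdd-element S (f ∘ suc)))
isOdd-element (outside ∷ S) f = trans (isOdd-element S (f ∘ suc))
  (cong (_xor dot (tabulate (f ∘ suc)) S) (sym (∧-zeroʳ (f zero))))

lookup-element : ∀ {n} (S : Subset n) i → lookup S (element S i) ≡ true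
lookup-element (inside  ∷ S) zero    = refl
lookup-element (inside  ∷ S) (suc i) = lookup-element S i
lookup-element (outside ∷ S) i       = lookup-element S i

element-surjective : ∀ {n} (S : Subset n) v → lookup S v ≡ true → ∃[ i ] element S i ≡ v
element-surjective (inside  ∷ S) zero    eq = zero , refl
element-surjective (inside  ∷ S) (suc v) eq with element-surjective S v eq
... | i , refl = suc i , refl
element-surjective (outside ∷ S) (suc v) eq with element-surjective S v eq
... | i , refl = i , refl

oddGraph⇒oddAt : ∀ G S → OddGraph (G [ S ]) → ∀ v → OddAt (neighbours G v) S v
oddGraph⇒oddAt G S odd v v∈S with element-surjective S v v∈S
... | i , refl = trans (sym (isOdd-element S (adj G (element S i)))) (%2⇒isOdd (degree (G [ S ]) i) (odd i))

oddAt⇒oddGraph : ∀ G S → (∀ v → OddAt (neighbours G v) S v) → OddGraph (G [ S ])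
oddAt⇒oddGraph G S odd i = isOdd⇒%2 (degree (G [ S ]) i)
  (trans (isOdd-element S (adj G (element S i))) (odd (element S i) (lookup-element S i)))

-- Reduces the two parts of a coloring to a single unknown vector.
∁-unique : ∀ {n} (S T : Subset n) → S ∪ T ≡ ⊤ → S ∩ T ≡ ⊥ → T ≡ ∁ S
∁-unique []            []            _  _  = refl
∁-unique (inside  ∷ S) (outside ∷ T) eq₁ eq₂ = cong (outside ∷_) (∁-unique S T (∷-injectiveʳ eq₁) (∷-injectiveʳ eq₂))
∁-unique (outside ∷ S) (inside  ∷ T) eq₁ eq₂ = cong (inside ∷_) (∁-unique S T (∷-injectiveʳ eq₁) (∷-injectiveʳ eq₂))

-- Colorings as solutions of the system

neighbours-irrefl : ∀ G v → lookup (neighbours G v) v ≡ false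
neighbours-irrefl G v = trans (lookup∘tabulate (adj G v) v) (adj-irrefl G v)

solvable⇒coloring : ∀ G → solvable (graphSystem (adj G)) ≡ true → HasOdd2Coloring G
solvable⇒coloring G eq with solvable-sound (graphSystem (adj G)) eq
... | x , sats = x , ∁ x , p∪∁p≡⊤ x , ∩-inverseʳ x ,
      oddAt⇒oddGraph G x (proj₁ ∘ odd) , oddAt⇒oddGraph G (∁ x) (proj₂ ∘ odd)
  where
  odd : ∀ v → OddAt (neighbours G v) x v × OddAt (neighbours G v) (∁ x) v
  odd v = equation⇒odd v (neighbours G v) x (neighbours-irrefl G v)
    (subst (λ r → dot r x ≡ not (parity (neighbours G v))) (fill-clears (parity (neighbours G v)) v (neighbours G v))
      (proj₂ (system-all⁻ {P = Satisfies x} (Vec.replicate (order G) true) (neighbours G) [] sats) v))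

coloring⇒solvable : ∀ G → HasOdd2Coloring G → solvable (graphSystem (adj G)) ≡ true
coloring⇒solvable G (x , y , x∪y , x∩y , odd₁ , odd₂) with ∁-unique x y x∪y x∩y
... | refl = solvable-complete (graphSystem (adj G)) {x}
  (system-all⁺ {P = Satisfies x} (Vec.replicate (order G) true) (neighbours G) [] [] λ v →
    subst (λ r → dot r x ≡ not (parity (neighbours G v))) (sym (fill-clears (parity (neighbours G v)) v (neighbours G v)))
      (odd⇒equation v (neighbours G v) x (neighbours-irrefl G v)
        (oddGraph⇒oddAt G x odd₁ v) (oddGraph⇒oddAt G (∁ x) odd₂ v)))

theorem3 : SolvableInPolynomialTime Odd2Coloring
theorem3 = machine , bound , λ G → answer G (solvable (graphSystem (adj G))) refl
  where
  answer : ∀ G d → solvable (graphSystem (adj G)) ≡ d →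
    let s = stateAfter (eval bound (length (encodeGraph G))) (encodeGraph G)
    in (HasOdd2Coloring G × s ≡ accept) ⊎ (¬ HasOdd2Coloring G × s ≡ reject)
  answer G true  eq = inj₁ (solvable⇒coloring G eq , trans (machine-verdict G) (cong verdict eq))
  answer G false eq = inj₂
    ( (λ col → contradiction (trans (sym (coloring⇒solvable G col)) eq) λ ())
    , trans (machine-verdict G) (cong verdict eq))
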